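{- For $n\ge 1$ let $S_n(3\overline{5}241)$ denote the set of permutations of $[n]=\{1,\dots,n\}$ that avoid the barred pattern $3\overline{5}241$. Then the sequence $(a_n)_{n\ge 1}$ defined by $a_1=1$ and $a_{n+1}=|S_n(3\overline{5}241)|$ for $n\ge 1$ is the left-shift eigensequence for self-composition.
   Context: Permutations are written as words $\pi=\pi_1\pi_2\cdots\pi_n$. Occurrences of patterns are as (not necessarily consecutive) subsequences in the same relative order. A permutation $\pi$ avoids the barred pattern $3\overline{5}241$ if every occurrence of the pattern $3241$ in $\pi$ is part of an occurrence of the pattern $35241$; that is, for all positions $i<j<k<l$ such that $\pi_i\pi_j\pi_k\pi_l$ is order-isomorphic to $3241$, there is a position $p$ with $i<p<j$ such that $\pi_i\pi_p\pi_j\pi_k\pi_l$ is order-isomorphic to $35241$ (equivalently, $\pi_p>\pi_k$). The composition of two sequences $(a_n)_{n\ge1}$ and $(b_n)_{n\ge1}$ is defined by composition of their ordinary generating functions $A(x)=\sum_{n\ge1}a_nx^n$ and $B(x)=\sum_{n\ge1}b_nx^n$ as formal power series. A sequence is unital if its first term is $1$. The left-shift eigensequence for self-composition is the unique unital sequence $(b_n)_{n\ge1}$ whose composition with itself equals its left shift $(b_2,b_3,\ldots)$; in terms of $B(x)=\sum_{n\ge1}b_nx^n$, this says $b_1=1$ and $B(B(x))=\sum_{n\ge1}b_{n+1}x^n=\frac{B(x)-x}{x}$. It begins $1,1,2,6,23,104,531,\ldots$. -}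

module Defs where

open import Data.Fin.Base as Fin using (Fin; toℕ)
open import Data.Fin.Properties as Fin using (all?; any?)
open import Data.Integer.Base using (ℤ; +_; _*_; 0ℤ; 1ℤ)
open import Data.Integer.Properties using (+-*-semiring)
open import Data.List.Base as List using (List; length; filter; allFin; cartesianProductWith)
open import Data.Nat.Base as ℕ using (ℕ; zero; suc; _∸_)
open import Data.Nat.Properties as ℕ using ()
open import Data.Product.Base using (∃-syntax; _×_; _,_; uncurry)
open import Data.Vec.Base using (Vec; []; _∷_; lookup; map)
open import Data.Vec.Relation.Unary.AllPairs using (allPairs?)
open import Data.Vec.Relation.Unary.Unique.Propositional using (Unique)
open import Function.Bundles using (_⇔_; mk⇔; module Equivalence)
open import Relation.Binary.PropositionalEquality.Core using (_≡_; _≗_)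
open import Relation.Nullary.Decidable using (Dec; map′; ¬?; _×-dec_; _→-dec_)
open import Relation.Unary using (Decidable)

open import Algebra.Properties.Semiring.Sum +-*-semiring using (sum)

-- Words of length m over an n-letter alphabet; the letter i of Fin n stands
-- for the element i + 1 of {1,…,n}.
Word : ℕ → ℕ → Set
Word n m = Vec (Fin n) m

-- Every word, listed exactly once.
allWords : ∀ n m → List (Word n m)
allWords n zero    = [] List.∷ List.[]
allWords n (suc m) = cartesianProductWith _∷_ (allFin n) (allWords n m)

-- n pairwise distinct letters out of n.
IsPermutation : ∀ {n} → Word n n → Set
IsPermutation = Unique

isPermutation? : ∀ {n} → Decidable (IsPermutation {n})
isPermutation? = allPairs? λ x y → ¬? (x Fin.≟ y)

OrderIsomorphic : ∀ {n m} → Word n m → Vec ℕ m → Set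
OrderIsomorphic u p =
  ∀ s t → (lookup u s Fin.< lookup u t) ⇔ (lookup p s ℕ.< lookup p t)

orderIsomorphic? : ∀ {n m} (u : Word n m) (p : Vec ℕ m) → Dec (OrderIsomorphic u p)
orderIsomorphic? u p = all? λ s → all? λ t →
  (lookup u s Fin.<? lookup u t) ⇔? (lookup p s ℕ.<? lookup p t)
  where
  _⇔?_ : ∀ {A B : Set} → Dec A → Dec B → Dec (A ⇔ B)
  a? ⇔? b? = map′ (uncurry mk⇔) (λ e → Equivalence.to e , Equivalence.from e)
                  ((a? →-dec b?) ×-dec (b? →-dec a?))

pattern3241 : Vec ℕ 4
pattern3241 = 3 ∷ 2 ∷ 4 ∷ 1 ∷ []

pattern35241 : Vec ℕ 5
pattern35241 = 3 ∷ 5 ∷ 2 ∷ 4 ∷ 1 ∷ []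

Occurs : ∀ {n m k} → Word n m → Vec (Fin m) k → Vec ℕ k → Set
Occurs π positions p = OrderIsomorphic (map (lookup π) positions) p

occurs? : ∀ {n m k} (π : Word n m) (positions : Vec (Fin m) k) (p : Vec ℕ k) →
          Dec (Occurs π positions p)
occurs? π positions p = orderIsomorphic? (map (lookup π) positions) p

-- Avoidance of the barred pattern 3 5̅ 2 4 1.
AvoidsBarred : ∀ {n m} → Word n m → Set
AvoidsBarred π = ∀ i j k l → i Fin.< j → j Fin.< k → k Fin.< l →
  Occurs π (i ∷ j ∷ k ∷ l ∷ []) pattern3241 →
  ∃[ p ] i Fin.< p × p Fin.< j × Occurs π (i ∷ p ∷ j ∷ k ∷ l ∷ []) pattern35241

avoidsBarred? : ∀ {n m} → Decidable (AvoidsBarred {n} {m})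
avoidsBarred? π = all? λ i → all? λ j → all? λ k → all? λ l →
  (i Fin.<? j) →-dec (j Fin.<? k) →-dec (k Fin.<? l) →-dec
  occurs? π (i ∷ j ∷ k ∷ l ∷ []) pattern3241 →-dec
  any? λ p → (i Fin.<? p) ×-dec (p Fin.<? j) ×-dec
             occurs? π (i ∷ p ∷ j ∷ k ∷ l ∷ []) pattern35241

avoiders : ∀ n → List (Word n n)
avoiders n = filter avoidsBarred? (filter isPermutation? (allWords n n))

-- A sequence (bₙ)ₙ≥₁ is stored with its indices lowered by one: b k is the
-- term with index k + 1.
Sequence : Set
Sequence = ℕ → ℤ

-- f n is the coefficient of xⁿ.
PowerSeries : Set
PowerSeries = ℕ → ℤ

infixl 7 _·_
_·_ : PowerSeries → PowerSeries → PowerSeries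
(f · g) n = sum {suc n} λ k → f (toℕ k) * g (n ∸ toℕ k)

one : PowerSeries
one zero    = 1ℤ
one (suc _) = 0ℤ

infixr 8 _^_
_^_ : PowerSeries → ℕ → PowerSeries
f ^ zero  = one
f ^ suc k = f · f ^ k

-- Substitution f(g(x)) = Σₖ fₖ g(x)ᵏ. Meaningful when g has zero constant
-- term; then gᵏ has no terms below xᵏ and the sum for xⁿ stops at k = n.
infixr 9 _⟨_⟩
_⟨_⟩ : PowerSeries → PowerSeries → PowerSeries
(f ⟨ g ⟩) n = sum {suc n} λ k → f (toℕ k) * (g ^ toℕ k) n

-- Ordinary generating function Σₙ≥₁ bₙ xⁿ.
ogf : Sequence → PowerSeries
ogf b zero    = 0ℤ
ogf b (suc k) = b k

Unital : Sequence → Set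
Unital b = b 0 ≡ 1ℤ

leftShift : Sequence → Sequence
leftShift b k = b (suc k)

IsUnitalShiftSolution : Sequence → Set
IsUnitalShiftSolution b = Unital b × (ogf b ⟨ ogf b ⟩ ≗ ogf (leftShift b))

IsLeftShiftEigensequence : Sequence → Set
IsLeftShiftEigensequence b =
  IsUnitalShiftSolution b × (∀ c → IsUnitalShiftSolution c → c ≗ b)

-- a₁ = 1 and aₙ₊₁ = |Sₙ(3 5̅ 2 4 1)| for n ≥ 1. At k ≥ 1 the entry is aₖ₊₁, so the
-- permutations counted have length k.
avoiderSequence : Sequence
avoiderSequence zero    = 1ℤ
avoiderSequence (suc k) = + length (avoiders (suc k))

{-# OPTIONS --safe #-}

-- Write an avoider with largest letter n as L n R. Then L and R are avoiders, and
-- no inversion c b of L (c > b) is followed by a letter a < b of R, since c b n a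
-- would be a 3241 that nothing can repair; conversely these conditions suffice.
-- Hence the letters of R lie above the lower letter of every inversion of L.
-- Generalise to pairs (P, Q) consisting of an avoider P and a set Q of h further
-- letters above the lower letter of every inversion of P. The largest letter of
-- P ∪ Q is either in Q, and is removed, or it splits P as L v R, and then R joins Q:
-- (L, Q ∪ R) is again such a pair, while R is any avoider on its t letters. With m
-- letters in total this gives
--   w(m+1, h) = w(m, h−1) + Σₜ aₜ w(m, h+t)   where aₜ = w(t, 0),
-- and induction on m identifies w(m, h) with the coefficient of x^(m+1) in B^(h+1)
-- for B = Σ aₜ x^(t+1). At h = 0 the recurrence is then B = x (1 + B(B(x))).
module Submission where

open import Defs

open import Data.Fin.Base as Fin using (Fin; toℕ; fromℕ<)
open import Data.Fin.Patterns using (0F; 1F; 2F; 3F; 4F)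
import Data.Fin.Properties as Fin
open import Data.Integer.Base using (ℤ; +_; _*_; _+_; 0ℤ; 1ℤ)
import Data.Integer.Properties as ℤ
open import Data.List.Base
  using (List; []; _∷_; _++_; [_]; length; map; take; drop; tabulate; allFin; upTo; applyUpTo; downFrom)
import Data.List.Properties as List
open import Data.List.Membership.Propositional using (_∈_; _∉_)
open import Data.List.Membership.Propositional.Properties
  using (∈-++⁺ˡ; ∈-++⁺ʳ; ∈-++⁻; ∈-∃++; ∈-insert; ∈-map⁻; ∈-filter⁺; ∈-filter⁻; ∈-allFin; ∈-upTo⁺; ∈-upTo⁻;
         ∈-downFrom⁺; ∈-downFrom⁻; ∈-cartesianProductWith⁺)
open import Data.List.Membership.Propositional.Properties.WithK using (unique∧set⇒bag)
open import Data.List.Relation.Binary.BagAndSetEquality using (∼bag⇒↭)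
open import Data.List.Relation.Binary.Permutation.Propositional
  using (_↭_; ↭-refl; ↭-sym; ↭-trans; ↭-reflexive; prep; ↭⇒↭ₛ; module PermutationReasoning)
import Data.List.Relation.Binary.Permutation.Propositional.Properties as ↭
import Data.List.Relation.Binary.Permutation.Setoid.Properties as ↭ₛ
open import Data.List.Relation.Binary.Sublist.Propositional as Sublist
  using (_⊆_; []; _∷_; _∷ʳ_; ⊆-trans; from∈; minimum)
open import Data.List.Relation.Binary.Sublist.Propositional.Properties as Sublist using (++⁺; ++⁺ˡ; ++⁺ʳ)
open import Data.List.Relation.Unary.All as All using (All; []; _∷_)
import Data.List.Relation.Unary.All.Properties as All
open import Data.List.Relation.Unary.AllPairs as AllPairs using (AllPairs; []; _∷_)
import Data.List.Relation.Unary.AllPairs.Properties as AllPairs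
open import Data.List.Relation.Unary.Any using (here; there)
open import Data.List.Relation.Unary.Sorted.TotalOrder.Properties using (Sorted⇒AllPairs)
open import Data.List.Relation.Unary.Unique.Propositional using (Unique)
import Data.List.Relation.Unary.Unique.Propositional.Properties as Unique
open import Data.Nat.Base as ℕ using (ℕ; zero; suc; _∸_; _≤_; _<_; _>_; z≤n; s≤s; z<s; s<s)
open import Data.Nat.Induction using (<-rec)
import Data.Nat.ListAction as ListAction
import Data.Nat.Properties as ℕ
open import Data.Product.Base using (∃; ∃₂; _×_; _,_; proj₁; proj₂)
open import Data.Sum.Base using (_⊎_; inj₁; inj₂; [_,_]′)
open import Data.Vec.Base as Vec using (Vec; []; _∷_; lookup)
import Data.Vec.Properties as Vec
open import Data.Vec.Relation.Unary.All using ([]; _∷_)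
import Data.Vec.Relation.Unary.All.Properties as VecAll
open import Data.Vec.Relation.Unary.AllPairs as VecAllPairs using ([]; _∷_)
open import Data.Vec.Relation.Unary.Unique.Propositional as VecUnique using ()
import Data.Vec.Relation.Unary.Unique.Propositional.Properties as VecUnique
open import Function.Base using (_∘_; id)
open import Function.Bundles using (_⇔_; mk⇔; module Equivalence)
open import Relation.Binary.Bundles using (DecTotalOrder)
open import Relation.Binary.Definitions using (Tri; tri<; tri≈; tri>)
open import Relation.Binary.PropositionalEquality hiding ([_])
open import Relation.Nullary using (¬_; contradiction)

open import Algebra.Properties.Semiring.Sum ℤ.+-*-semiring
  using (sum; sum-cong-≗; ∑-distrib-+; ∑-comm; *-distribˡ-sum)
open import Relation.Binary.Properties.DecTotalOrder ℕ.≤-decTotalOrder using (≥-decTotalOrder)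
import Data.List.Sort ≥-decTotalOrder as Sort

-- Power series

Σ< : ℕ → (ℕ → ℤ) → ℤ
Σ< n f = sum {n} (f ∘ toℕ)

Σ<-cong : ∀ n {f g : ℕ → ℤ} → (∀ k → k < n → f k ≡ g k) → Σ< n f ≡ Σ< n g
Σ<-cong n f≡g = sum-cong-≗ λ i → f≡g (toℕ i) (Fin.toℕ<n i)

Σ<-zero : ∀ n {f : ℕ → ℤ} → (∀ k → k < n → f k ≡ 0ℤ) → Σ< n f ≡ 0ℤ
Σ<-zero zero    f≡0 = refl
Σ<-zero (suc n) f≡0 = cong₂ _+_ (f≡0 0 (s≤s z≤n)) (Σ<-zero n λ k k<n → f≡0 (suc k) (s≤s k<n))

Σ<-extend : ∀ {n N} {f : ℕ → ℤ} → n ≤ N → (∀ k → n ≤ k → f k ≡ 0ℤ) → Σ< N f ≡ Σ< n f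
Σ<-extend {N = N} z≤n       f≡0 = Σ<-zero N λ k _ → f≡0 k z≤n
Σ<-extend {f = f} (s≤s n≤N) f≡0 = cong (_+_ (f 0)) (Σ<-extend n≤N λ k n≤k → f≡0 (suc k) (s≤s n≤k))

·-cong : ∀ {f f′ g g′ : PowerSeries} n → (∀ k → k ≤ n → f k ≡ f′ k) → (∀ k → k ≤ n → g k ≡ g′ k) →
         (f · g) n ≡ (f′ · g′) n
·-cong n f≡ g≡ = Σ<-cong (suc n) λ k k<1+n → cong₂ _*_ (f≡ k (ℕ.s≤s⁻¹ k<1+n)) (g≡ (n ∸ k) (ℕ.m∸n≤m n k))

^-cong : ∀ {f g : PowerSeries} k n → (∀ i → i ≤ n → f i ≡ g i) → (f ^ k) n ≡ (g ^ k) n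
^-cong zero    n f≡g = refl
^-cong (suc k) n f≡g = ·-cong n f≡g λ i i≤n → ^-cong k i λ j j≤i → f≡g j (ℕ.≤-trans j≤i i≤n)

⟨⟩-cong : ∀ {f g : PowerSeries} n → (∀ i → i ≤ n → f i ≡ g i) → (f ⟨ f ⟩) n ≡ (g ⟨ g ⟩) n
⟨⟩-cong n f≡g = Σ<-cong (suc n) λ k k<1+n → cong₂ _*_ (f≡g k (ℕ.s≤s⁻¹ k<1+n)) (^-cong k n f≡g)

-- The coefficients of B(B(x)) up to degree n determine the one of B in degree n + 1.
shiftSolution-unique : ∀ {b c} → IsUnitalShiftSolution b → IsUnitalShiftSolution c → c ≗ b
shiftSolution-unique {b} {c} (b₀ , b∘b) (c₀ , c∘c) n = ogf-≡ (suc n)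
  where
  ogf-≡ : ∀ n → ogf c n ≡ ogf b n
  ogf-≡ = <-rec _ λ
    { zero          _  → refl
    ; (suc zero)    _  → trans c₀ (sym b₀)
    ; (suc (suc k)) ih → trans (sym (c∘c (suc k)))
                         (trans (⟨⟩-cong (suc k) λ i i≤1+k → ih (s≤s i≤1+k)) (b∘b (suc k)))
    }

-- `ogf b` is x times the series with coefficients `b`: its constant term contributes nothing and
-- the rest shifts by one. On the right `b` itself is read as a power series.
ogf·-suc : ∀ b (g : PowerSeries) n → (ogf b · g) (suc n) ≡ (b · g) n
ogf·-suc b g n = ℤ.+-identityˡ _

-- Each factor `ogf b` is divisible by x, so it raises the order by at least one.
ogf-^-vanishes : ∀ b {j} k → j < k → (ogf b ^ k) j ≡ 0ℤ
ogf-^-vanishes b {zero}  (suc k) j<k = refl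
ogf-^-vanishes b {suc j} (suc k) (s≤s j<k) =
  trans (ogf·-suc b (ogf b ^ k) j)
        (Σ<-zero (suc j) λ i _ →
          trans (cong (b i *_) (ogf-^-vanishes b k (ℕ.≤-<-trans (ℕ.m∸n≤m j i) j<k))) (ℤ.*-zeroʳ (b i)))

-- The counterpart of `ogf·-suc` for a right factor divisible by x. The vanishing term is now the
-- last of the convolution, so the induction peels off coefficients of `f` until it is reached.
·-sucʳ : ∀ (f g : PowerSeries) n → g 0 ≡ 0ℤ → (f · g) (suc n) ≡ (f · (g ∘ suc)) n
·-sucʳ f g zero    g₀ = cong (_+_ (f 0 * g 1)) (cong (_+ 0ℤ) (trans (cong (f 1 *_) g₀) (ℤ.*-zeroʳ (f 1))))
·-sucʳ f g (suc n) g₀ = cong (_+_ (f 0 * g (2 ℕ.+ n))) (·-sucʳ (f ∘ suc) g n g₀)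

·-one : ∀ (f : PowerSeries) n → (f · one) n ≡ f n
·-one f zero    = trans (ℤ.+-identityʳ _) (ℤ.*-identityʳ (f 0))
·-one f (suc n) = trans (cong₂ _+_ (ℤ.*-zeroʳ (f 0)) (·-one (f ∘ suc) n)) (ℤ.+-identityˡ _)

Σ<-distrib-+ : ∀ n (f g : ℕ → ℤ) → Σ< n (λ k → f k + g k) ≡ Σ< n f + Σ< n g
Σ<-distrib-+ n f g = ∑-distrib-+ {n} (f ∘ toℕ) (g ∘ toℕ)

Σ<-comm : ∀ m n (f : ℕ → ℕ → ℤ) → Σ< m (λ i → Σ< n (f i)) ≡ Σ< n (λ j → Σ< m λ i → f i j)
Σ<-comm m n f = ∑-comm {m} {n} λ i j → f (toℕ i) (toℕ j)

*-distribˡ-Σ< : ∀ n x (f : ℕ → ℤ) → x * Σ< n f ≡ Σ< n λ k → x * f k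
*-distribˡ-Σ< n x f = *-distribˡ-sum {n} x (f ∘ toℕ)

·-linearʳ : ∀ (f g : PowerSeries) N (c : Sequence) (G : ℕ → PowerSeries) n →
            (f · (λ j → g j + Σ< N λ t → c t * G t j)) n ≡ (f · g) n + Σ< N λ t → c t * (f · G t) n
·-linearʳ f g N c G n = begin
  (Σ< (suc n) λ k → f k * (g (n ∸ k) + Σ< N (term k)))
    ≡⟨ Σ<-cong (suc n) {g = λ k → f k * g (n ∸ k) + Σ< N (λ t → f k * term k t)} (λ k _ → trans
         (ℤ.*-distribˡ-+ (f k) (g (n ∸ k)) (Σ< N (term k)))
         (cong (_+_ (f k * g (n ∸ k))) (*-distribˡ-Σ< N (f k) (term k)))) ⟩
  (Σ< (suc n) λ k → f k * g (n ∸ k) + Σ< N λ t → f k * term k t)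
    ≡⟨ Σ<-distrib-+ (suc n) (λ k → f k * g (n ∸ k)) (λ k → Σ< N λ t → f k * term k t) ⟩
  (f · g) n + (Σ< (suc n) λ k → Σ< N λ t → f k * term k t)
    ≡⟨ cong (_+_ ((f · g) n)) (Σ<-comm (suc n) N (λ k t → f k * term k t)) ⟩
  (f · g) n + (Σ< N λ t → Σ< (suc n) λ k → f k * term k t)
    ≡⟨ cong (_+_ ((f · g) n)) (Σ<-cong N {g = λ t → c t * (f · G t) n} λ t _ → trans
         (Σ<-cong (suc n) {g = λ k → c t * (f k * G t (n ∸ k))} λ k _ → swap (f k) (c t) (G t (n ∸ k)))
         (sym (*-distribˡ-Σ< (suc n) (c t) (λ k → f k * G t (n ∸ k))))) ⟩
  (f · g) n + (Σ< N λ t → c t * (f · G t) n) ∎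
  where
  open ≡-Reasoning
  term : ℕ → ℕ → ℤ
  term k t = c t * G t (n ∸ k)
  swap : ∀ x y z → x * (y * z) ≡ y * (x * z)
  swap x y z = trans (sym (ℤ.*-assoc x y z)) (trans (cong (_* z) (ℤ.*-comm x y)) (ℤ.*-assoc y x z))

-- The hypothesis is B = x (1 + B(B(x))) in low degrees; multiply it by Bʰ.
^-recurrence : ∀ b M N →
  (∀ {j} → j ≤ M → ogf b (suc j) ≡ one j + Σ< N λ t → b t * (ogf b ^ suc t) j) →
  ∀ h {j} → j ≤ M → (ogf b ^ suc h) (suc j) ≡ (ogf b ^ h) j + Σ< N λ t → b t * (ogf b ^ (h ℕ.+ suc t)) j
^-recurrence b M N base zero    {j}     j≤M = trans (·-one (ogf b) (suc j)) (base j≤M)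
^-recurrence b M N base (suc h) {zero}  j≤M = begin
  (ogf b ^ (2 ℕ.+ h)) 1                                          ≡⟨ ogf·-suc b (ogf b ^ suc h) 0 ⟩
  b 0 * 0ℤ + 0ℤ                                                  ≡⟨ cong (_+ 0ℤ) (ℤ.*-zeroʳ (b 0)) ⟩
  0ℤ                                                             ≡⟨ Σ<-zero N {λ t → b t * 0ℤ} (λ t _ → ℤ.*-zeroʳ (b t)) ⟨
  (Σ< N λ t → b t * 0ℤ)                                          ≡⟨ ℤ.+-identityˡ _ ⟨
  0ℤ + (Σ< N λ t → b t * 0ℤ)                                     ∎
  where open ≡-Reasoning
-- An x is taken from each of two factors: the first turns `ogf b` into `b`, the second shifts
-- `ogf b ^ suc h` so that the recurrence for `h` applies under the product. Linearity distributes
-- `b`, and the first x is then put back in every term.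
^-recurrence b M N base (suc h) {suc j} j≤M = begin
  (ogf b ^ (2 ℕ.+ h)) (2 ℕ.+ j)                                  ≡⟨ ogf·-suc b (ogf b ^ suc h) (suc j) ⟩
  (b · (ogf b ^ suc h)) (suc j)                                  ≡⟨ ·-sucʳ b (ogf b ^ suc h) j refl ⟩
  (b · ((ogf b ^ suc h) ∘ suc)) j
    ≡⟨ ·-cong {b} {b} {(ogf b ^ suc h) ∘ suc} {λ j → (ogf b ^ h) j + Σ< N λ t → b t * (ogf b ^ (h ℕ.+ suc t)) j} j (λ _ _ → refl)
         (λ k k≤j → ^-recurrence b M N base h (ℕ.≤-trans (ℕ.m≤n⇒m≤1+n k≤j) j≤M)) ⟩
  (b · (λ j → (ogf b ^ h) j + Σ< N λ t → b t * (ogf b ^ (h ℕ.+ suc t)) j)) j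
    ≡⟨ ·-linearʳ b (ogf b ^ h) N b (λ t → ogf b ^ (h ℕ.+ suc t)) j ⟩
  (b · (ogf b ^ h)) j + (Σ< N λ t → b t * (b · (ogf b ^ (h ℕ.+ suc t))) j)
    ≡⟨ cong₂ _+_ (ogf·-suc b (ogf b ^ h) j)
         (Σ<-cong N {λ t → b t * (ogf b ^ (suc h ℕ.+ suc t)) (suc j)} λ t _ → cong (b t *_) (ogf·-suc b (ogf b ^ (h ℕ.+ suc t)) j)) ⟨
  (ogf b ^ suc h) (suc j) + (Σ< N λ t → b t * (ogf b ^ (suc h ℕ.+ suc t)) (suc j)) ∎
  where open ≡-Reasoning

-- The size of Built S h below, for a descending S of length m.
mutual
  count : (ℕ → ℕ) → ℕ → ℕ → ℕ
  count a zero    zero    = 1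
  count a zero    (suc h) = 0
  count a (suc m) zero    = nodeCount a m zero
  count a (suc m) (suc h) = count a m h ℕ.+ nodeCount a m (suc h)

  nodeCount : (ℕ → ℕ) → ℕ → ℕ → ℕ
  nodeCount a m h = ListAction.sum (map (λ t → count a m (h ℕ.+ t) ℕ.* a t) (upTo (suc m)))

pos-sum-applyUpTo : ∀ n (f : ℕ → ℕ) → + ListAction.sum (applyUpTo f n) ≡ Σ< n (+_ ∘ f)
pos-sum-applyUpTo zero    f = refl
pos-sum-applyUpTo (suc n) f = cong (_+_ (+ f 0)) (pos-sum-applyUpTo n (f ∘ suc))

-- Counts as coefficients of powers of the generating function

module _ (a : ℕ → ℕ) (b : Sequence) (b≡a : ∀ n → b n ≡ + a n) where

  private
    B : PowerSeries
    B = ogf b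

  pos-nodeCount : ∀ m h → + nodeCount a m h ≡ Σ< (suc m) λ t → b t * + count a m (h ℕ.+ t)
  pos-nodeCount m h = begin
    + ListAction.sum (map f (upTo (suc m)))          ≡⟨ cong (+_ ∘ ListAction.sum) (List.map-upTo f (suc m)) ⟩
    + ListAction.sum (applyUpTo f (suc m))           ≡⟨ pos-sum-applyUpTo (suc m) f ⟩
    Σ< (suc m) (+_ ∘ f)                              ≡⟨ Σ<-cong (suc m) (λ t _ → convert t) ⟩
    (Σ< (suc m) λ t → b t * + count a m (h ℕ.+ t))   ∎
    where
    open ≡-Reasoning
    f : ℕ → ℕ
    f t = count a m (h ℕ.+ t) ℕ.* a t
    convert : ∀ t → + f t ≡ b t * + count a m (h ℕ.+ t)
    convert t = trans (ℤ.pos-* (count a m (h ℕ.+ t)) (a t))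
      (trans (ℤ.*-comm (+ count a m (h ℕ.+ t)) (+ a t)) (cong (_* + count a m (h ℕ.+ t)) (sym (b≡a t))))

  module _ (count≡a : ∀ m → count a m 0 ≡ a m) where

    b₀≡1 : b 0 ≡ 1ℤ
    b₀≡1 = trans (b≡a 0) (cong +_ (sym (count≡a 0)))

    -- Strong induction on `m`, for all `h` at once. Through `count≡a`, each low coefficient of `B`
    -- unfolds into smaller counts, which the induction hypothesis turns into coefficients of powers
    -- of `B`. This is the base equation of `^-recurrence`, whose conclusion matches the recurrence
    -- defining `count`.
    count-coefficient : ∀ m h → + count a m h ≡ (B ^ suc h) (suc m)
    count-coefficient = <-rec _ step
      where
      open ≡-Reasoning
      step : ∀ m → (∀ {j} → j < m → ∀ h → + count a j h ≡ (B ^ suc h) (suc j)) →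
             ∀ h → + count a m h ≡ (B ^ suc h) (suc m)
      step zero    ih zero    = sym (trans (·-one B 1) b₀≡1)
      step zero    ih (suc h) = sym (ogf-^-vanishes b (2 ℕ.+ h) (s≤s (s≤s z≤n)))
      step (suc m) ih h       = trans (peel h) (sym (^-recurrence b (suc m) (suc m) base h ℕ.≤-refl))
        where
        base : ∀ {j} → j ≤ suc m → B (suc j) ≡ one j + Σ< (suc m) λ t → b t * (B ^ suc t) j
        base {zero} _ = begin
          b 0                                         ≡⟨ b₀≡1 ⟩
          1ℤ                                          ≡⟨ ℤ.+-identityʳ 1ℤ ⟨
          1ℤ + 0ℤ                                     ≡⟨ cong (_+_ 1ℤ) (Σ<-zero (suc m) {λ t → b t * 0ℤ} (λ t _ → ℤ.*-zeroʳ (b t))) ⟨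
          1ℤ + (Σ< (suc m) λ t → b t * 0ℤ)            ∎
        base {suc j} (s≤s j≤m) = begin
          b (suc j)                                            ≡⟨ b≡a (suc j) ⟩
          + a (suc j)                                          ≡⟨ cong +_ (count≡a (suc j)) ⟨
          + count a (suc j) 0                                  ≡⟨ pos-nodeCount j 0 ⟩
          (Σ< (suc j) λ t → b t * + count a j t)
            ≡⟨ Σ<-cong (suc j) (λ t _ → cong (b t *_) (ih (s≤s j≤m) t)) ⟩
          (Σ< (suc j) λ t → b t * (B ^ suc t) (suc j))
            -- For t > j the power `B ^ suc t` has order above `suc j`, so the sum may be lengthened
            -- to the bound `suc m`, common to all j.
            ≡⟨ Σ<-extend (s≤s j≤m) (λ t j<t → trans (cong (b t *_) (ogf-^-vanishes b (suc t) (s≤s j<t))) (ℤ.*-zeroʳ (b t))) ⟨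
          (Σ< (suc m) λ t → b t * (B ^ suc t) (suc j))         ≡⟨ ℤ.+-identityˡ _ ⟨
          0ℤ + (Σ< (suc m) λ t → b t * (B ^ suc t) (suc j))    ∎

        nodes : ∀ h → + nodeCount a m h ≡ Σ< (suc m) λ t → b t * (B ^ (h ℕ.+ suc t)) (suc m)
        nodes h = trans (pos-nodeCount m h) (Σ<-cong (suc m) λ t _ → cong (b t *_)
          (trans (ih ℕ.≤-refl (h ℕ.+ t)) (cong (λ k → (B ^ k) (suc m)) (sym (ℕ.+-suc h t)))))

        -- The term `B ^ h` stands for removing the largest letter from Q. At h = 0 it is a
        -- coefficient of `one` in positive degree, hence 0, in agreement with `count`.
        peel : ∀ h → + count a (suc m) h ≡ (B ^ h) (suc m) + Σ< (suc m) λ t → b t * (B ^ (h ℕ.+ suc t)) (suc m)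
        peel zero    = trans (nodes 0) (sym (ℤ.+-identityˡ _))
        peel (suc h) = trans (ℤ.pos-+ (count a m h) _) (cong₂ _+_ (ih ℕ.≤-refl h) (nodes (suc h)))

    -- The term of index `t` in the coefficient of B(B(x)) counts the decompositions with `t`
    -- letters after the largest one, so the sum is the recurrence for `count` at h = 0.
    isUnitalShiftSolution : IsUnitalShiftSolution b
    isUnitalShiftSolution = b₀≡1 , λ
      { zero    → refl
      ; (suc n) → begin
          0ℤ + (Σ< (suc n) λ t → b t * (B ^ suc t) (suc n))   ≡⟨ ℤ.+-identityˡ _ ⟩
          (Σ< (suc n) λ t → b t * (B ^ suc t) (suc n))
            ≡⟨ Σ<-cong (suc n) (λ t _ → cong (b t *_) (count-coefficient n t)) ⟨
          (Σ< (suc n) λ t → b t * + count a n t)              ≡⟨ pos-nodeCount n 0 ⟨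
          + count a (suc n) 0                                 ≡⟨ cong +_ (count≡a (suc n)) ⟩
          + a (suc n)                                         ≡⟨ b≡a (suc n) ⟨
          b (suc n)                                           ∎
      }
      where open ≡-Reasoning

-- Decomposition of avoiders at the largest letter

Desc : List ℕ → Set
Desc = AllPairs _>_

Desc⇒Unique : ∀ {xs} → Desc xs → Unique xs
Desc⇒Unique = AllPairs.map (λ x>y → ≢-sym (ℕ.<⇒≢ x>y))

AllPairs-++⁻ : ∀ {A : Set} {_~_ : A → A → Set} xs {ys} → AllPairs _~_ (xs ++ ys) →
               AllPairs _~_ xs × AllPairs _~_ ys × All (λ x → All (x ~_) ys) xs
AllPairs-++⁻ []       ys~          = [] , ys~ , []
AllPairs-++⁻ (x ∷ xs) (x~ ∷ rest) =
  let xs~ , ys~ , xs~ys = AllPairs-++⁻ xs rest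
  in All.++⁻ˡ xs x~ ∷ xs~ , ys~ , All.++⁻ʳ xs x~ ∷ xs~ys

Unique-resp-↭ : ∀ {A : Set} {xs ys : List A} → xs ↭ ys → Unique xs → Unique ys
Unique-resp-↭ {A} = ↭ₛ.Unique-resp-↭ (setoid A) ∘ ↭⇒↭ₛ

-- Descending lists are normal forms of finite sets of letters. `Node-injective` relies on this to
-- recover a list from the letters of R.
Desc-↭⇒≡ : ∀ {xs ys} → Desc xs → Desc ys → xs ↭ ys → xs ≡ ys
Desc-↭⇒≡ {[]}     {ys}     _ _ p = sym (↭.↭-empty-inv (↭-sym p))
Desc-↭⇒≡ {x ∷ xs} {[]}     _ _ p = contradiction p ↭.¬x∷xs↭[]
Desc-↭⇒≡ {x ∷ xs} {y ∷ ys} (x> ∷ dxs) (y> ∷ dys) p = helper (ℕ.≤-antisym x≤y y≤x)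
  where
  bound : ∀ {z zs w} → All (z >_) zs → w ∈ z ∷ zs → w ≤ z
  bound z> (here refl) = ℕ.≤-refl
  bound z> (there w∈)  = ℕ.<⇒≤ (All.lookup z> w∈)
  x≤y : x ≤ y
  x≤y = bound y> (↭.∈-resp-↭ p (here refl))
  y≤x : y ≤ x
  y≤x = bound x> (↭.∈-resp-↭ (↭-sym p) (here refl))
  helper : x ≡ y → x ∷ xs ≡ y ∷ ys
  helper refl = cong (x ∷_) (Desc-↭⇒≡ dxs dys (↭.drop-∷ p))

sortDesc : ∀ {xs} → Unique xs → ∃ λ ys → Desc ys × xs ↭ ys
sortDesc {xs} u = Sort.sort xs , AllPairs.zipWith (λ (x≥y , x≢y) → ℕ.≤∧≢⇒< x≥y (≢-sym x≢y)) (sorted , unique) , p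
  where
  p : xs ↭ Sort.sort xs
  p = ↭-sym (Sort.sort-↭ xs)
  unique : Unique (Sort.sort xs)
  unique = Unique-resp-↭ p u
  sorted : AllPairs (λ x y → y ≤ x) (Sort.sort xs)
  sorted = Sorted⇒AllPairs (DecTotalOrder.totalOrder ≥-decTotalOrder) (Sort.sort-↗ xs)

⊆-++⁻ : ∀ {A : Set} {xs : List A} ys {zs} → xs ⊆ ys ++ zs →
        ∃₂ λ us vs → xs ≡ us ++ vs × us ⊆ ys × vs ⊆ zs
⊆-++⁻ {xs = xs} [] τ = [] , xs , refl , [] , τ
⊆-++⁻ (y ∷ ys) (.y ∷ʳ τ) with us , vs , eq , σ , ρ ← ⊆-++⁻ ys τ = us , vs , eq , y ∷ʳ σ , ρ
⊆-++⁻ (y ∷ ys) (refl ∷ τ) with us , vs , eq , σ , ρ ← ⊆-++⁻ ys τ = y ∷ us , vs , cong (y ∷_) eq , refl ∷ σ , ρ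

++-disjoint : ∀ {A : Set} {x : A} xs {ys} → Unique (xs ++ ys) → x ∈ xs → x ∉ ys
++-disjoint xs u x∈xs x∈ys = All.lookup (All.lookup (proj₂ (proj₂ (AllPairs-++⁻ xs u))) x∈xs) x∈ys refl

-- The part of the sublist that falls in `zs` is a suffix. If nonempty it contains `x`, which
-- already occurs in `ys`, against uniqueness.
⊆-++⁻ˡ : ∀ {A : Set} {x : A} us {ys zs} → Unique (ys ++ zs) → x ∈ ys → us ++ [ x ] ⊆ ys ++ zs → us ++ [ x ] ⊆ ys
⊆-++⁻ˡ {x = x} us {ys} u x∈ys τ with ⊆-++⁻ ys τ
... | ps , []     , eq , σ , ρ = subst (_⊆ ys) (sym (trans eq (List.++-identityʳ ps))) σ
... | ps , q ∷ qs , eq , σ , ρ = contradiction (Sublist.lookup ρ x∈qs) (++-disjoint ys u x∈ys)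
  where
  last∈ : ∀ us ps {q qs} → us ++ [ x ] ≡ ps ++ q ∷ qs → x ∈ q ∷ qs
  last∈ []       []            refl = here refl
  last∈ (u ∷ us) []            refl = ∈-++⁺ʳ (u ∷ us) (here refl)
  last∈ []       (p ∷ [])      ()
  last∈ []       (p ∷ _ ∷ _)   ()
  last∈ (u ∷ us) (p ∷ ps)      eq   = last∈ us ps (List.∷-injectiveʳ eq)
  x∈qs : x ∈ q ∷ qs
  x∈qs = last∈ us ps eq

⊆-++⁻ʳ : ∀ {A : Set} {x : A} {vs} ys {zs} → Unique (ys ++ zs) → x ∈ zs → x ∷ vs ⊆ ys ++ zs → x ∷ vs ⊆ zs
⊆-++⁻ʳ ys u x∈zs τ with ⊆-++⁻ ys τ
... | []     , _ , refl , _ , ρ = ρ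
... | x ∷ us , _ , refl , σ , _ = contradiction x∈zs (++-disjoint ys u (Sublist.lookup σ (here refl)))

-- Letters stand for positions, so this is faithful only when P has no repeated letters.
Avoids : List ℕ → Set
Avoids P = ∀ {c b d a} → c ∷ b ∷ d ∷ a ∷ [] ⊆ P → a < b → b < c → c < d →
           ∃ λ e → d < e × c ∷ e ∷ b ∷ d ∷ a ∷ [] ⊆ P

-- The further letters form a descending list, so that each set has one representative and its
-- largest letter stands at the head.
record Good (S P Q : List ℕ) : Set where
  field
    perm   : P ++ Q ↭ S
    desc   : Desc Q
    avoids : Avoids P
    above  : ∀ {c b} → c ∷ b ∷ [] ⊆ P → b < c → All (b <_) Q

-- Build S P Q: P is an avoider, Q is descending and above the lower letter of
-- every inversion of P, and together they use the letters of S. Appending ∞ and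
-- then Q to P preserves avoidance exactly under these conditions.
data Build : (S P Q : List ℕ) → Set where
  leaf : Build [] [] []
  tail : ∀ {v S P Q} → Build S P Q → Build (v ∷ S) P (v ∷ Q)
  -- `U` is the descending list of the letters of `R`. It can be placed after `Q` because `v` forms
  -- an inversion with every letter of `R`, which forces these below all of `Q`.
  node : ∀ {v S L R} Q {U} → Build S L (Q ++ U) → Build U R [] → Build (v ∷ S) (L ++ v ∷ R) Q

open Good

good-node : ∀ {v S L R} Q {U} → All (v >_) S → Good S L (Q ++ U) → Good U R [] → Good (v ∷ S) (L ++ v ∷ R) Q
good-node {v} {S} {L} {R} Q {U} v>S gL gR = record
  { perm   = permutation
  ; desc   = proj₁ Q++U
  ; avoids = avoid
  ; above  = above′
  }
  where
  Q++U = AllPairs-++⁻ Q (desc gL)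
  R↭U : R ↭ U
  R↭U = ↭-trans (↭-reflexive (sym (List.++-identityʳ R))) (perm gR)
  R⇒U : ∀ {x} → x ∈ R → x ∈ U
  R⇒U = ↭.∈-resp-↭ R↭U
  v>L : ∀ {x} → x ∈ L → x < v
  v>L x∈L = All.lookup v>S (↭.∈-resp-↭ (perm gL) (∈-++⁺ˡ x∈L))
  v>R : ∀ {x} → x ∈ R → x < v
  v>R x∈R = All.lookup v>S (↭.∈-resp-↭ (perm gL) (∈-++⁺ʳ L (∈-++⁺ʳ Q (R⇒U x∈R))))

  permutation : (L ++ v ∷ R) ++ Q ↭ v ∷ S
  permutation = begin
    (L ++ v ∷ R) ++ Q     ≡⟨ List.++-assoc L (v ∷ R) Q ⟩
    L ++ v ∷ R ++ Q       ↭⟨ ↭.shift v L (R ++ Q) ⟩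
    v ∷ L ++ R ++ Q       ↭⟨ prep v (↭.++⁺ˡ L (↭.++-comm R Q)) ⟩
    v ∷ L ++ Q ++ R       ↭⟨ prep v (↭.++⁺ˡ L (↭.++⁺ˡ Q R↭U)) ⟩
    v ∷ L ++ Q ++ U       ↭⟨ prep v (perm gL) ⟩
    v ∷ S                 ∎
    where open PermutationReasoning

  R<Q : ∀ {x} → x ∈ R → All (x <_) Q
  R<Q x∈R = All.map (λ U<q → All.lookup U<q (R⇒U x∈R)) (proj₂ (proj₂ Q++U))

  no-drop : ∀ {c b a} → c ∷ b ∷ [] ⊆ L → b < c → a ∈ v ∷ R → ¬ a < b
  no-drop σ b<c (here refl) a<b = ℕ.<-asym a<b (v>L (Sublist.lookup σ (there (here refl))))
  no-drop σ b<c (there a∈R) a<b = ℕ.<-asym a<b (All.lookup (All.++⁻ʳ Q (above gL σ b<c)) (R⇒U a∈R))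

  -- Cases by how many letters of the 3241 lie in L. With none or four, R or L supplies the repair;
  -- with exactly one, `v` itself serves as the 5. With two or three, the inversion in L is followed
  -- by a smaller letter, contradicting `no-drop`. The letter `v` is too large to be the 3 or the 2.
  avoid : Avoids (L ++ v ∷ R)
  avoid τ a<b b<c c<d with ⊆-++⁻ L τ
  ... | [] , _ , refl , _ , (refl ∷ ρ) = contradiction (v>R (Sublist.lookup ρ (there (here refl)))) (ℕ.<-asym c<d)
  ... | [] , _ , refl , _ , (.v ∷ʳ ρ) =
    let e , d<e , ρ′ = avoids gR ρ a<b b<c c<d in e , d<e , ++⁺ (minimum L) (v ∷ʳ ρ′)
  ... | c ∷ [] , _ , refl , σ , (refl ∷ ρ) = contradiction (v>L (Sublist.lookup σ (here refl))) (ℕ.<-asym b<c)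
  ... | c ∷ [] , _ , refl , σ , (.v ∷ʳ ρ) =
    v , v>R (Sublist.lookup ρ (there (here refl))) , ++⁺ σ (refl ∷ ρ)
  ... | c ∷ b ∷ [] , _ , refl , σ , ρ = contradiction a<b (no-drop σ b<c (Sublist.lookup ρ (there (here refl))))
  ... | c ∷ b ∷ d ∷ [] , _ , refl , σ , ρ =
    contradiction a<b (no-drop (⊆-trans (refl ∷ refl ∷ minimum (d ∷ [])) σ) b<c (Sublist.lookup ρ (here refl)))
  ... | c ∷ b ∷ d ∷ a ∷ [] , _ , refl , σ , ρ =
    let e , d<e , σ′ = avoids gL σ a<b b<c c<d in e , d<e , ++⁺ σ′ ρ

  above′ : ∀ {c b} → c ∷ b ∷ [] ⊆ L ++ v ∷ R → b < c → All (b <_) Q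
  above′ τ b<c with ⊆-++⁻ L τ
  ... | [] , _ , refl , _ , (_ ∷ ρ)            = R<Q (Sublist.lookup ρ (here refl))
  ... | [] , _ , refl , _ , (.v ∷ʳ ρ)          = R<Q (Sublist.lookup ρ (there (here refl)))
  ... | c ∷ [] , _ , refl , σ , (refl ∷ ρ)     = contradiction b<c (ℕ.<-asym (v>L (Sublist.lookup σ (here refl))))
  ... | c ∷ [] , _ , refl , σ , (.v ∷ʳ ρ)      = R<Q (Sublist.lookup ρ (here refl))
  ... | c ∷ b ∷ [] , [] , refl , σ , ρ         = All.++⁻ˡ Q (above gL σ b<c)

Build⇒Good : ∀ {S P Q} → Desc S → Build S P Q → Good S P Q
Build⇒Good _          leaf = record { perm = ↭-refl ; desc = [] ; avoids = λ () ; above = λ () }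
Build⇒Good (v>S ∷ dS) (tail {v} {P = P} {Q} t) = record
  { perm   = ↭-trans (↭.shift v P Q) (prep v (perm g))
  ; desc   = All.tabulate (λ x∈Q → All.lookup v>S (↭.∈-resp-↭ (perm g) (∈-++⁺ʳ P x∈Q))) ∷ desc g
  ; avoids = avoids g
  ; above  = λ σ b<c →
      All.lookup v>S (↭.∈-resp-↭ (perm g) (∈-++⁺ˡ (Sublist.lookup σ (there (here refl))))) ∷ above g σ b<c
  }
  where g = Build⇒Good dS t
Build⇒Good (v>S ∷ dS) (node {L = L} Q tL tR) = good-node Q v>S gL (Build⇒Good dU tR)
  where
  gL = Build⇒Good dS tL
  dU = proj₁ (proj₂ (AllPairs-++⁻ Q (desc gL)))

good-[]⁻ : ∀ {P Q} → Good [] P Q → Build [] P Q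
good-[]⁻ {[]}    {[]}    _ = leaf
good-[]⁻ {[]}    {_ ∷ _} g = contradiction (perm g) ↭.¬x∷xs↭[]
good-[]⁻ {_ ∷ _}         g = contradiction (perm g) ↭.¬x∷xs↭[]

good-tail⁻ : ∀ {v S P Q} → Good (v ∷ S) P (v ∷ Q) → Good S P Q
good-tail⁻ {P = P} g = record
  { perm   = ↭.drop-mid P [] (perm g)
  ; desc   = AllPairs.tail (desc g)
  ; avoids = avoids g
  ; above  = λ σ b<c → All.tail (above g σ b<c)
  }

module _ {v S L R Q} (dS : Desc (v ∷ S)) (g : Good (v ∷ S) (L ++ v ∷ R) Q) where

  private
    v>S : All (v >_) S
    v>S = AllPairs.head dS

    perm′ : L ++ R ++ Q ↭ S
    perm′ = ↭.drop-mid L [] (↭-trans (↭-reflexive (sym (List.++-assoc L (v ∷ R) Q))) (perm g))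

    unique : Unique (L ++ v ∷ R)
    unique = proj₁ (AllPairs-++⁻ (L ++ v ∷ R) (Unique-resp-↭ (↭-sym (perm g)) (Desc⇒Unique dS)))

    v>R : ∀ {x} → x ∈ R → x < v
    v>R x∈R = All.lookup v>S (↭.∈-resp-↭ perm′ (∈-++⁺ʳ L (∈-++⁺ˡ x∈R)))

    R<Q : ∀ {x} → x ∈ R → All (x <_) Q
    R<Q x∈R = above g (++⁺ˡ L (refl ∷ from∈ x∈R)) (v>R x∈R)

    v≥ : ∀ {x} → x ∈ L ++ v ∷ R → x ≤ v
    v≥ x∈ with ↭.∈-resp-↭ (perm g) (∈-++⁺ˡ x∈)
    ... | here refl = ℕ.≤-refl
    ... | there x∈S = ℕ.<⇒≤ (All.lookup v>S x∈S)

    -- Otherwise c b v r would be a 3241, and nothing exceeds v.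
    L-inversion<R : ∀ {c b r} → c ∷ b ∷ [] ⊆ L → b < c → r ∈ R → b < r
    L-inversion<R {c} {b} {r} σ b<c r∈R with ℕ.<-cmp r b
    ... | tri> _ _ b<r  = b<r
    ... | tri≈ _ refl _ = contradiction (there r∈R) (++-disjoint L unique (Sublist.lookup σ (there (here refl))))
    ... | tri< r<b _ _  =
      let e , v<e , τ = avoids g (++⁺ σ (refl ∷ from∈ r∈R)) r<b b<c
                          (ℕ.≤∧≢⇒< (v≥ (∈-++⁺ˡ c∈L)) λ { refl → ++-disjoint L unique c∈L (here refl) })
      in contradiction v<e (ℕ.≤⇒≯ (v≥ (Sublist.lookup τ (there (here refl)))))
      where
      c∈L : c ∈ L
      c∈L = Sublist.lookup σ (here refl)

  Unique-R : Unique R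
  Unique-R = AllPairs.tail (proj₁ (proj₂ (AllPairs-++⁻ L unique)))

  -- A 3241 inside L is repaired in the whole word. Its last letter lies in L, so the repairing
  -- letter, which comes earlier, does too.
  good-nodeˡ⁻ : ∀ {U} → Desc U → R ↭ U → Good S L (Q ++ U)
  good-nodeˡ⁻ {U} dU R↭U = record
    { perm   = ↭-trans (↭.++⁺ˡ L (↭-trans (↭.++-comm Q U) (↭.++⁺ʳ Q (↭-sym R↭U)))) perm′
    ; desc   = AllPairs.++⁺ (desc g) dU
                 (All.tabulate λ q∈Q → All.tabulate λ u∈U → All.lookup (R<Q (U⇒R u∈U)) q∈Q)
    ; avoids = λ {c} {b} {d} σ a<b b<c c<d →
        let e , d<e , τ = avoids g (++⁺ʳ (v ∷ R) σ) a<b b<c c<d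
        in e , d<e , ⊆-++⁻ˡ (c ∷ e ∷ b ∷ d ∷ []) unique (Sublist.lookup σ (there (there (there (here refl))))) τ
    ; above  = λ σ b<c → All.++⁺ (above g (++⁺ʳ (v ∷ R) σ) b<c)
                 (All.tabulate λ u∈U → L-inversion<R σ b<c (U⇒R u∈U))
    }
    where
    U⇒R : ∀ {x} → x ∈ U → x ∈ R
    U⇒R = ↭.∈-resp-↭ (↭-sym R↭U)

  -- A 3241 inside R starts in R, so its repair comes later and is again in R. `strip` discards `v`,
  -- which exceeds the first letter of the pattern.
  good-nodeʳ⁻ : ∀ {U} → R ↭ U → Good U R []
  good-nodeʳ⁻ R↭U = record
    { perm   = ↭-trans (↭-reflexive (List.++-identityʳ R)) R↭U
    ; desc   = []
    ; avoids = λ σ a<b b<c c<d →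
        let c∈R = Sublist.lookup σ (here refl)
            e , d<e , τ = avoids g (++⁺ˡ L (v ∷ʳ σ)) a<b b<c c<d
        in e , d<e , strip (v>R c∈R) (⊆-++⁻ʳ L unique (there c∈R) τ)
    ; above  = λ _ _ → []
    }
    where
    strip : ∀ {c vs} → c < v → c ∷ vs ⊆ v ∷ R → c ∷ vs ⊆ R
    strip c<v (refl ∷ _) = contradiction c<v (ℕ.<-irrefl refl)
    strip _   (.v ∷ʳ τ)  = τ

  length-R≤ : length R ≤ length S
  length-R≤ = begin
    length R                     ≤⟨ ℕ.m≤m+n _ _ ⟩
    length R ℕ.+ length Q        ≡⟨ List.length-++ R ⟨
    length (R ++ Q)              ≤⟨ ℕ.m≤n+m _ _ ⟩
    length L ℕ.+ length (R ++ Q) ≡⟨ List.length-++ L ⟨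
    length (L ++ R ++ Q)         ≡⟨ ↭.↭-length perm′ ⟩
    length S                     ∎
    where open ℕ.≤-Reasoning

-- The right part is built over the sorted list `U`, which is not a subterm of `S`; hence the
-- recursion on a bound for the length.
Good⇒Build : ∀ {S P Q} → Desc S → Good S P Q → Build S P Q
Good⇒Build {S} = bounded (length S) ℕ.≤-refl
  where
  bounded : ∀ n {S P Q} → length S ≤ n → Desc S → Good S P Q → Build S P Q
  bounded n       {[]}             _         _  g = good-[]⁻ g
  bounded (suc n) {v ∷ S} {P} {Q} (s≤s S≤n) dS@(v>S ∷ dS′) g
    with ∈-++⁻ P (↭.∈-resp-↭ (↭-sym (perm g)) (here refl))
  ... | inj₂ (here refl) = tail (bounded n S≤n dS′ (good-tail⁻ g))
  -- `v` is the maximum of all letters and `Q` descends, so `v` cannot stand behind the head of `Q`.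
  ... | inj₂ (there {q} v∈Q) with ↭.∈-resp-↭ (perm g) (∈-++⁺ʳ P (here {x = q} refl))
  ...   | here refl = contradiction (All.lookup (AllPairs.head (desc g)) v∈Q) (ℕ.<-irrefl refl)
  ...   | there q∈S = contradiction (All.lookup (AllPairs.head (desc g)) v∈Q) (ℕ.<-asym (All.lookup v>S q∈S))
  bounded (suc n) {v ∷ S} {P} {Q} (s≤s S≤n) dS@(v>S ∷ dS′) g | inj₁ v∈P
    with L , R , refl ← ∈-∃++ v∈P
    with U , dU , R↭U ← sortDesc (Unique-R dS g) =
    node Q (bounded n S≤n dS′ (good-nodeˡ⁻ dS g dU R↭U))
           (bounded n (ℕ.≤-trans (ℕ.≤-reflexive (sym (↭.↭-length R↭U))) (ℕ.≤-trans (length-R≤ dS g) S≤n)) dU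
                    (good-nodeʳ⁻ dS g R↭U))

-- Counting

-- Membership is only logically equivalent to `R x`, so an element counts once however many proofs
-- of `R x` there are.
record HasSize {X : Set} (R : X → Set) (n : ℕ) : Set where
  constructor hasSize
  field
    elements  : List X
    unique    : Unique elements
    member    : ∀ x → x ∈ elements ⇔ R x
    size      : length elements ≡ n

module _ {X : Set} where

  HasSize-cong : ∀ {R R′ : X → Set} {n} → (∀ x → R x ⇔ R′ x) → HasSize R n → HasSize R′ n
  HasSize-cong R⇔R′ (hasSize xs u m s) = hasSize xs u
    (λ x → mk⇔ (Equivalence.to (R⇔R′ x) ∘ Equivalence.to (m x)) (Equivalence.from (m x) ∘ Equivalence.from (R⇔R′ x))) s

  HasSize-unique : ∀ {R : X → Set} {m n} → HasSize R m → HasSize R n → m ≡ n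
  HasSize-unique (hasSize xs ux mx sx) (hasSize ys uy my sy) = trans (sym sx) (trans (↭.↭-length xs↭ys) sy)
    where
    xs↭ys : xs ↭ ys
    xs↭ys = ∼bag⇒↭ (unique∧set⇒bag ux uy λ {x} →
      mk⇔ (Equivalence.from (my x) ∘ Equivalence.to (mx x)) (Equivalence.from (mx x) ∘ Equivalence.to (my x)))

  HasSize-∅ : ∀ {R : X → Set} → (∀ x → ¬ R x) → HasSize R 0
  HasSize-∅ ¬R = hasSize [] [] (λ x → mk⇔ (λ ()) λ Rx → contradiction Rx (¬R x)) refl

  HasSize-singleton : ∀ (x : X) → HasSize (_≡ x) 1
  HasSize-singleton x = hasSize [ x ] ([] ∷ []) (λ y → mk⇔ (λ { (here y≡x) → y≡x ; (there ()) }) here) refl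

  HasSize-⊎ : ∀ {R R′ : X → Set} {m n} → (∀ {x} → R x → ¬ R′ x) →
              HasSize R m → HasSize R′ n → HasSize (λ x → R x ⊎ R′ x) (m ℕ.+ n)
  HasSize-⊎ disj (hasSize xs ux mx sx) (hasSize ys uy my sy) = hasSize (xs ++ ys)
    (Unique.++⁺ ux uy λ {x} (x∈xs , x∈ys) → disj (Equivalence.to (mx x) x∈xs) (Equivalence.to (my x) x∈ys))
    (λ x → mk⇔ ([ inj₁ ∘ Equivalence.to (mx x) , inj₂ ∘ Equivalence.to (my x) ]′ ∘ ∈-++⁻ xs)
               [ ∈-++⁺ˡ ∘ Equivalence.from (mx x) , ∈-++⁺ʳ xs ∘ Equivalence.from (my x) ]′)
    (trans (List.length-++ xs) (cong₂ ℕ._+_ sx sy))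

module _ {X Y : Set} where

  -- The last hypothesis makes the sets `T x` pairwise disjoint, so their sizes add up.
  HasSize-∃∈ : ∀ {T : X → Y → Set} {f : X → ℕ} {xs : List X} → Unique xs →
               (∀ {x} → x ∈ xs → HasSize (T x) (f x)) →
               (∀ {x x′ y} → x ∈ xs → x′ ∈ xs → T x y → T x′ y → x ≡ x′) →
               HasSize (λ y → ∃ λ x → x ∈ xs × T x y) (ListAction.sum (map f xs))
  HasSize-∃∈ []       _     _    = HasSize-∅ λ { _ (_ , () , _) }
  HasSize-∃∈ (x∉ ∷ u) sizes inj = HasSize-cong
    (λ y → mk⇔ [ (λ Ty → _ , here refl , Ty) , (λ (x , x∈ , Ty) → x , there x∈ , Ty) ]′
               λ { (x , here refl , Ty) → inj₁ Ty ; (x , there x∈ , Ty) → inj₂ (x , x∈ , Ty) })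
    (HasSize-⊎ (λ Ty (x′ , x′∈ , Ty′) → All.lookup x∉ x′∈ (inj (here refl) (there x′∈) Ty Ty′))
      (sizes (here refl))
      (HasSize-∃∈ u (sizes ∘ there) (λ x∈ x′∈ → inj (there x∈) (there x′∈))))

  HasSize-∃ : ∀ {R : X → Set} {T : X → Y → Set} {n k} → HasSize R n →
              (∀ {x} → R x → HasSize (T x) k) →
              (∀ {x x′ y} → R x → R x′ → T x y → T x′ y → x ≡ x′) →
              HasSize (λ y → ∃ λ x → R x × T x y) (n ℕ.* k)
  HasSize-∃ {T = T} {k = k} (hasSize xs u m refl) sizes inj = HasSize-cong
    (λ y → mk⇔ (λ (x , x∈ , Ty) → x , Equivalence.to (m x) x∈ , Ty)
               (λ (x , Rx , Ty) → x , Equivalence.from (m x) Rx , Ty))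
    (subst (HasSize _) (sum-map-const xs)
      (HasSize-∃∈ u (λ {x} x∈ → sizes (Equivalence.to (m x) x∈))
        (λ {x} {x′} x∈ x′∈ → inj (Equivalence.to (m x) x∈) (Equivalence.to (m x′) x′∈))))
    where
    sum-map-const : ∀ (xs : List X) → ListAction.sum (map (λ _ → k) xs) ≡ length xs ℕ.* k
    sum-map-const []       = refl
    sum-map-const (_ ∷ xs) = cong (k ℕ.+_) (sum-map-const xs)

  HasSize-image : ∀ {R : X → Set} {n} (f : X → Y) → (∀ {x x′} → R x → R x′ → f x ≡ f x′ → x ≡ x′) →
                  HasSize R n → HasSize (λ y → ∃ λ x → R x × y ≡ f x) n
  HasSize-image f inj s = subst (HasSize _) (ℕ.*-identityʳ _)
    (HasSize-∃ s (λ {x} _ → HasSize-singleton (f x)) (λ Rx Rx′ y≡fx y≡fx′ → inj Rx Rx′ (trans (sym y≡fx) y≡fx′)))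

module _ {A : Set} where

  take-length-++ : ∀ {n} (xs : List A) ys → length xs ≡ n → take n (xs ++ ys) ≡ xs
  take-length-++ []       ys refl = refl
  take-length-++ (x ∷ xs) ys refl = cong (x ∷_) (take-length-++ xs ys refl)

  drop-length-++ : ∀ {n} (xs : List A) ys → length xs ≡ n → drop n (xs ++ ys) ≡ ys
  drop-length-++ []       ys refl = refl
  drop-length-++ (x ∷ xs) ys refl = drop-length-++ xs ys refl

  ++∷-injective : ∀ {v : A} xs xs′ {ys ys′} → v ∉ xs → v ∉ xs′ → xs ++ v ∷ ys ≡ xs′ ++ v ∷ ys′ → xs ≡ xs′ × ys ≡ ys′
  ++∷-injective []       []         _  _   refl = refl , refl
  ++∷-injective []       (x′ ∷ xs′) _  v∉′ eq   = contradiction (here (List.∷-injectiveˡ eq)) v∉′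
  ++∷-injective (x ∷ xs) []         v∉ _   eq   = contradiction (here (sym (List.∷-injectiveˡ eq))) v∉
  ++∷-injective (x ∷ xs) (x′ ∷ xs′) v∉ v∉′ eq   =
    let xs≡ , ys≡ = ++∷-injective xs xs′ (v∉ ∘ there) (v∉′ ∘ there) (List.∷-injectiveʳ eq)
    in cong₂ _∷_ (List.∷-injectiveˡ eq) xs≡ , ys≡

-- Sizes of the sets of pairs over given letters

Built : List ℕ → ℕ → List ℕ × List ℕ → Set
Built S h (P , Q) = Build S P Q × length Q ≡ h

Build-↭ : ∀ {S P} → Desc S → Build S P [] → P ↭ S
Build-↭ {P = P} dS t = ↭-trans (↭-reflexive (sym (List.++-identityʳ P))) (Good.perm (Build⇒Good dS t))

Build-∉ : ∀ {v S P Q} → Desc (v ∷ S) → Build S P Q → v ∉ P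
Build-∉ (v>S ∷ dS) t v∈P =
  ℕ.<-irrefl refl (All.lookup v>S (↭.∈-resp-↭ (Good.perm (Build⇒Good dS t)) (∈-++⁺ˡ v∈P)))

-- The pairs obtained by `node` from a fixed left pair. The letters of `R` come last in `Q′`, so
-- cutting after `h` letters separates `Q` from `U`. `Built` at 0 forces `Q₀` to be empty.
Node : ℕ → ℕ → List ℕ × List ℕ → List ℕ × List ℕ → Set
Node v h (L , Q′) y = ∃ λ ((R , Q₀) : List ℕ × List ℕ) → Built (drop h Q′) 0 (R , Q₀) × y ≡ (L ++ v ∷ R , take h Q′)

-- `t` is the number of letters of R. Sorting by `t` gives all left pairs in a class the same number
-- `a t` of right parts.
Built-node : ∀ v S h → List ℕ × List ℕ → Set
Built-node v S h y = ∃ λ t → t ∈ upTo (suc (length S)) × ∃ λ x → Built S (h ℕ.+ t) x × Node v h x y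

module _ {v S} (dvS : Desc (v ∷ S)) where

  private
    dS : Desc S
    dS = AllPairs.tail dvS

    Desc-Q : ∀ {P Q} → Build S P Q → Desc Q
    Desc-Q t = Good.desc (Build⇒Good dS t)

  node⇒ : ∀ {P Q} L U {R} → Build S L (Q ++ U) → Build U R [] → P ≡ L ++ v ∷ R →
          Built-node v S (length Q) (P , Q)
  node⇒ {Q = Q} L U tL tR refl =
    length U , ∈-upTo⁺ (s≤s U≤S) , (L , Q ++ U) , (tL , List.length-++ Q) ,
    _ , (subst (λ U → Build U _ []) (sym (drop-length-++ Q U refl)) tR , refl) ,
    cong (_ ,_) (sym (take-length-++ Q U refl))
    where
    open ℕ.≤-Reasoning
    U≤S : length U ≤ length S
    U≤S = begin
      length U                     ≤⟨ ℕ.m≤n+m _ _ ⟩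
      length Q ℕ.+ length U        ≡⟨ List.length-++ Q ⟨
      length (Q ++ U)              ≤⟨ ℕ.m≤n+m _ _ ⟩
      length L ℕ.+ length (Q ++ U) ≡⟨ List.length-++ L ⟨
      length (L ++ (Q ++ U))       ≡⟨ ↭.↭-length (Good.perm (Build⇒Good dS tL)) ⟩
      length S                     ∎

  node⇐ : ∀ {h P Q} → Built-node v S h (P , Q) → Built (v ∷ S) h (P , Q)
  node⇐ {h} (t , _ , (L , Q′) , (tL , Q′≡) , (R , []) , (tR , _) , refl) =
    node (take h Q′) (subst (Build S L) (sym (List.take++drop≡id h Q′)) tL) tR ,
    trans (List.length-take h Q′) (trans (cong (h ℕ.⊓_) Q′≡) (ℕ.m≤n⇒m⊓n≡m (ℕ.m≤m+n h t)))

  node-∈ : ∀ {h P Q} → Built-node v S h (P , Q) → v ∈ P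
  node-∈ (_ , _ , (L , _) , _ , _ , _ , refl) = ∈-insert L

  Built-zero⇔ : ∀ y → Built-node v S 0 y ⇔ Built (v ∷ S) 0 y
  Built-zero⇔ (P , Q) = mk⇔ node⇐ λ { (node {L = L} [] {U} tL tR , refl) → node⇒ L U tL tR refl }

  Built-suc⇔ : ∀ h y → ((∃ λ x → Built S h x × y ≡ (proj₁ x , v ∷ proj₂ x)) ⊎ Built-node v S (suc h) y) ⇔
                       Built (v ∷ S) (suc h) y
  Built-suc⇔ h (P , Q) = mk⇔
    [ (λ { (_ , (t , refl) , refl) → tail t , refl }) , node⇐ ]′
    (λ { (tail t , refl) → inj₁ (_ , (t , refl) , refl)
       ; (node {L = L} (q ∷ Q) {U} tL tR , refl) → inj₂ (node⇒ L U tL tR refl) })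

  length-drop≡ : ∀ {h t} (Q : List ℕ) → length Q ≡ h ℕ.+ t → length (drop h Q) ≡ t
  length-drop≡ {h} {t} Q Q≡ = trans (List.length-drop h Q) (trans (cong (_∸ h) Q≡) (ℕ.m+n∸m≡n h t))

  -- The place of `v`, which is absent from `L` and `L′`, determines the left and right parts. The
  -- letters of the right part in descending order are the dropped end of `Q`, and `t` is its
  -- length.
  Node-injective : ∀ {h t t′ x x′ y} → Built S (h ℕ.+ t) x → Built S (h ℕ.+ t′) x′ →
                   Node v h x y → Node v h x′ y → t ≡ t′ × x ≡ x′
  Node-injective {h} {t} {t′} {L , Q} {L′ , Q′} (tL , Q≡) (tL′ , Q′≡) ((R , []) , (tR , _) , refl) ((R′ , []) , (tR′ , _) , y≡)
    with refl , refl ← ++∷-injective L L′ (Build-∉ dvS tL) (Build-∉ dvS tL′) (cong proj₁ y≡) =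
    trans (sym (length-drop≡ Q Q≡)) (trans (cong length drop≡) (length-drop≡ Q′ Q′≡)) ,
    cong (L ,_) (begin
      Q                       ≡⟨ List.take++drop≡id h Q ⟨
      take h Q ++ drop h Q    ≡⟨ cong₂ _++_ (cong proj₂ y≡) drop≡ ⟩
      take h Q′ ++ drop h Q′  ≡⟨ List.take++drop≡id h Q′ ⟩
      Q′                      ∎)
    where
    open ≡-Reasoning
    dU : Desc (drop h Q)
    dU = AllPairs.drop⁺ h (Desc-Q tL)
    dU′ : Desc (drop h Q′)
    dU′ = AllPairs.drop⁺ h (Desc-Q tL′)
    drop≡ : drop h Q ≡ drop h Q′
    drop≡ = Desc-↭⇒≡ dU dU′ (↭-trans (↭-sym (Build-↭ dU tR)) (Build-↭ dU′ tR′))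

  module _ (a : ℕ → ℕ)
           (sizeS : ∀ h → HasSize (Built S h) (count a (length S) h))
           (sizeU : ∀ {U} → length U ≤ length S → Desc U → HasSize (Built U 0) (a (length U))) where

    Node-size : ∀ {h t x} → t ∈ upTo (suc (length S)) → Built S (h ℕ.+ t) x → HasSize (Node v h x) (a t)
    Node-size {h} {t} {L , Q} t∈ (tL , Q≡) with refl ← length-drop≡ {h} {t} Q Q≡ =
      HasSize-image (λ (R , _) → L ++ v ∷ R , take h Q)
        (λ { {R , []} {R′ , []} (_ , _) (_ , _) eq →
             cong (_, []) (List.∷-injectiveʳ (List.++-cancelˡ L _ _ (cong proj₁ eq))) })
        (sizeU (ℕ.s≤s⁻¹ (∈-upTo⁻ t∈)) (AllPairs.drop⁺ h (Desc-Q tL)))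

    Built-node-size : ∀ h → HasSize (Built-node v S h) (nodeCount a (length S) h)
    Built-node-size h = HasSize-∃∈ (Unique.upTo⁺ (suc (length S)))
      (λ {t} t∈ → HasSize-∃ (sizeS (h ℕ.+ t)) (Node-size t∈) (λ b b′ n n′ → proj₂ (Node-injective b b′ n n′)))
      (λ _ _ (_ , b , n) (_ , b′ , n′) → proj₁ (Node-injective b b′ n n′))

    Built-size : ∀ h → HasSize (Built (v ∷ S) h) (count a (suc (length S)) h)
    Built-size zero    = HasSize-cong Built-zero⇔ (Built-node-size 0)
    Built-size (suc h) = HasSize-cong (Built-suc⇔ h)
      (HasSize-⊎ (λ { (_ , (t , _) , refl) n → Build-∉ dvS t (node-∈ n) })
        (HasSize-image (λ (P , Q) → P , v ∷ Q) (λ { _ _ refl → refl }) (sizeS h))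
        (Built-node-size (suc h)))

Built-[]-size : ∀ a h → HasSize (Built [] h) (count a 0 h)
Built-[]-size a zero    = HasSize-cong
  (λ _ → mk⇔ (λ { refl → leaf , refl }) (λ { (leaf , _) → refl })) (HasSize-singleton ([] , []))
Built-[]-size a (suc h) = HasSize-∅ λ { _ (leaf , ()) }

Desc-downFrom : ∀ n → Desc (downFrom n)
Desc-downFrom n = AllPairs.applyDownFrom⁺₁ id n λ j<i _ → j<i

module _ (a : ℕ → ℕ) (a-size : ∀ n → HasSize (Built (downFrom n) 0) (a n)) where

  -- The recurrence needs the size `a t` for every set `U` of t letters, while `a-size` speaks only
  -- of `downFrom t`. By the induction hypothesis both have size `count a t 0`, so `a t` carries
  -- over to `U`.
  count-size : ∀ m {S} → length S ≡ m → Desc S → ∀ h → HasSize (Built S h) (count a m h)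
  count-size = <-rec _ λ
    { zero    ih {[]}    _    _            → Built-[]-size a
    ; (suc m) ih {v ∷ S} refl dS@(_ ∷ dS′) → Built-size dS a (ih ℕ.≤-refl refl dS′)
        (λ {U} U≤S dU → subst (HasSize _)
          (HasSize-unique (ih (s≤s U≤S) (List.length-downFrom (length U)) (Desc-downFrom (length U)) 0) (a-size (length U)))
          (ih (s≤s U≤S) refl dU 0))
    }

  count≡a : ∀ m → count a m 0 ≡ a m
  count≡a m = HasSize-unique (count-size m (List.length-downFrom m) (Desc-downFrom m) 0) (a-size m)

-- From positions in words to sublists of letters

lookup-mono : ∀ {n m} {v : Vec (Fin n) m} → VecAllPairs.AllPairs Fin._<_ v →
              ∀ {i j} → i Fin.< j → lookup v i Fin.< lookup v j
lookup-mono (v< ∷ _)  {Fin.zero}  {Fin.suc j} _         = VecAll.lookup⁺ v< j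
lookup-mono (_ ∷ vs<) {Fin.suc i} {Fin.suc j} (s<s i<j) = lookup-mono vs< i<j

-- An occurrence is exhibited by listing its letters in increasing order as `v`; the pattern is then
-- the list `σ` of indices into `v`, with `suc` because pattern values start at 1.
orderIsomorphic-sorted : ∀ {n m k} {v : Vec (Fin n) m} → VecAllPairs.AllPairs Fin._<_ v → (σ : Vec (Fin m) k) →
                         OrderIsomorphic (Vec.map (lookup v) σ) (Vec.map (suc ∘ toℕ) σ)
orderIsomorphic-sorted {v = v} v< σ s t
  rewrite Vec.lookup-map s (lookup v) σ | Vec.lookup-map t (lookup v) σ
        | Vec.lookup-map s (suc ∘ toℕ) σ | Vec.lookup-map t (suc ∘ toℕ) σ = mk⇔ to (lookup-mono v< ∘ ℕ.s≤s⁻¹)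
  where
  i = lookup σ s
  j = lookup σ t
  to : lookup v i Fin.< lookup v j → suc (toℕ i) < suc (toℕ j)
  to vᵢ<vⱼ with Fin.<-cmp i j
  ... | tri< i<j _ _ = s<s i<j
  ... | tri≈ _ i≡j _ = contradiction (cong (toℕ ∘ lookup v) i≡j) (ℕ.<⇒≢ vᵢ<vⱼ)
  ... | tri> _ _ j<i = contradiction vᵢ<vⱼ (ℕ.<-asym (lookup-mono v< j<i))

occurs-35241 : ∀ {n} {a b c d e : Fin n} → a Fin.< b → b Fin.< c → c Fin.< d → d Fin.< e →
               OrderIsomorphic (c ∷ e ∷ b ∷ d ∷ a ∷ []) pattern35241
occurs-35241 a<b b<c c<d d<e = orderIsomorphic-sorted
  ((a<b ∷ a<c ∷ ℕ.<-trans a<c c<d ∷ ℕ.<-trans (ℕ.<-trans a<c c<d) d<e ∷ []) ∷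
   (b<c ∷ ℕ.<-trans b<c c<d ∷ ℕ.<-trans b<c (ℕ.<-trans c<d d<e) ∷ []) ∷
   (c<d ∷ ℕ.<-trans c<d d<e ∷ []) ∷ (d<e ∷ []) ∷ [] ∷ [])
  (2F ∷ 4F ∷ 1F ∷ 3F ∷ 0F ∷ [])
  where
  a<c = ℕ.<-trans a<b b<c

occurs-3241 : ∀ {n} {a b c d : Fin n} → a Fin.< b → b Fin.< c → c Fin.< d →
              OrderIsomorphic (c ∷ b ∷ d ∷ a ∷ []) pattern3241
occurs-3241 a<b b<c c<d = orderIsomorphic-sorted
  ((a<b ∷ ℕ.<-trans a<b b<c ∷ ℕ.<-trans a<b (ℕ.<-trans b<c c<d) ∷ []) ∷
   (b<c ∷ ℕ.<-trans b<c c<d ∷ []) ∷ (c<d ∷ []) ∷ [] ∷ [])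
  (2F ∷ 1F ∷ 3F ∷ 0F ∷ [])

AllPairs-resp-⊆ : ∀ {A : Set} {_~_ : A → A → Set} {xs ys} → xs ⊆ ys → AllPairs _~_ ys → AllPairs _~_ xs
AllPairs-resp-⊆ []         []        = []
AllPairs-resp-⊆ (_ ∷ʳ τ)   (_ ∷ ys~) = AllPairs-resp-⊆ τ ys~
AllPairs-resp-⊆ (refl ∷ τ) (y~ ∷ ys~) = Sublist.All-resp-⊆ τ y~ ∷ AllPairs-resp-⊆ τ ys~

⊆-map⁻ : ∀ {A B : Set} (f : A → B) {xs} ys → xs ⊆ map f ys → ∃ λ zs → zs ⊆ ys × map f zs ≡ xs
⊆-map⁻ f []       []         = [] , [] , refl
⊆-map⁻ f (y ∷ ys) (_ ∷ʳ τ)   = let zs , σ , eq = ⊆-map⁻ f ys τ in zs , y ∷ʳ σ , eq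
⊆-map⁻ f (y ∷ ys) (refl ∷ τ) = let zs , σ , eq = ⊆-map⁻ f ys τ in y ∷ zs , refl ∷ σ , cong (f y ∷_) eq

∈-∷⁻-> : ∀ {n} {j k : Fin n} {js} → k ∈ j ∷ js → j Fin.< k → k ∈ js
∈-∷⁻-> (here refl) j<j = contradiction j<j (ℕ.<-irrefl refl)
∈-∷⁻-> (there k∈)  _   = k∈

increasing⇒⊆ : ∀ {n} {is js : List (Fin n)} → AllPairs Fin._<_ is → AllPairs Fin._<_ js →
               (∀ {i} → i ∈ is → i ∈ js) → is ⊆ js
increasing⇒⊆ {js = js}              []          _           _   = minimum js
increasing⇒⊆ {is = i ∷ is} {[]}     _           _           sub = contradiction (sub (here refl)) λ ()
increasing⇒⊆ {is = i ∷ is} {j ∷ js} (i< ∷ is<) (j< ∷ js<) sub with sub (here refl)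
... | here refl  = refl ∷ increasing⇒⊆ is< js< λ k∈ → ∈-∷⁻-> (sub (there k∈)) (All.lookup i< k∈)
... | there i∈js = j ∷ʳ increasing⇒⊆ (i< ∷ is<) js< λ k∈ →
                     ∈-∷⁻-> (sub k∈) (ℕ.<-≤-trans (All.lookup j< i∈js) (i≤ k∈))
  where
  i≤ : ∀ {k} → k ∈ i ∷ is → i Fin.≤ k
  i≤ (here refl) = ℕ.≤-refl
  i≤ (there k∈)  = ℕ.<⇒≤ (All.lookup i< k∈)

allFin-increasing : ∀ n → AllPairs Fin._<_ (allFin n)
allFin-increasing n = AllPairs.tabulate⁺-< id

-- Pigeonhole, by deleting the head of `xs` from `ys`. It shows that n distinct letters below n
-- exhaust `downFrom n`.
Unique-⊆⇒↭ : ∀ {A : Set} {xs ys : List A} → Unique xs → (∀ {x} → x ∈ xs → x ∈ ys) → length ys ≤ length xs → xs ↭ ys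
Unique-⊆⇒↭ {xs = []}     {[]}    _        _   _  = ↭-refl
Unique-⊆⇒↭ {xs = x ∷ xs} {ys} (x∉ ∷ u) sub ≤len
  with ys₁ , ys₂ , refl ← ∈-∃++ (sub (here refl)) =
  ↭-trans (prep x (Unique-⊆⇒↭ u sub′ len′)) (↭-sym (↭.shift x ys₁ ys₂))
  where
  sub′ : ∀ {z} → z ∈ xs → z ∈ ys₁ ++ ys₂
  sub′ z∈ with ∈-++⁻ ys₁ (sub (there z∈))
  ... | inj₁ z∈₁         = ∈-++⁺ˡ z∈₁
  ... | inj₂ (here refl) = contradiction refl (All.lookup x∉ z∈)
  ... | inj₂ (there z∈₂) = ∈-++⁺ʳ ys₁ z∈₂
  len′ : length (ys₁ ++ ys₂) ≤ length xs
  len′ = ℕ.s≤s⁻¹ (subst (_≤ suc (length xs)) (↭.↭-length (↭.shift x ys₁ ys₂)) ≤len)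

module _ {n m : ℕ} (π : Word n m) where

  letter : Fin m → ℕ
  letter = toℕ ∘ lookup π

  -- Written as an image of `allFin m`, so that sublists of letters lift to increasing lists of
  -- positions.
  word : List ℕ
  word = map letter (allFin m)

  increasing⇒⊆word : ∀ {is} → AllPairs Fin._<_ is → map letter is ⊆ word
  increasing⇒⊆word is< = Sublist.map⁺ letter (increasing⇒⊆ is< (allFin-increasing m) (λ _ → ∈-allFin _))

  ⊆word⇒increasing : ∀ {xs} → xs ⊆ word → ∃ λ is → AllPairs Fin._<_ is × map letter is ≡ xs
  ⊆word⇒increasing τ = let is , σ , eq = ⊆-map⁻ letter (allFin m) τ in is , AllPairs-resp-⊆ σ (allFin-increasing m) , eq

  AvoidsBarred⇒Avoids : AvoidsBarred π → Avoids word
  AvoidsBarred⇒Avoids avoids τ a<b b<c c<d with ⊆word⇒increasing τ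
  ... | i ∷ j ∷ k ∷ l ∷ [] , ((i<j ∷ i<k ∷ i<l ∷ []) ∷ (j<k ∷ j<l ∷ []) ∷ (k<l ∷ []) ∷ [] ∷ []) , refl =
    let p , i<p , p<j , occ = avoids i j k l i<j j<k k<l (occurs-3241 a<b b<c c<d)
    -- Entries 3 and 1 of 35241, counted from 0, are the 4 and the 5.
    in letter p , Equivalence.from (occ 3F 1F) (s<s (s<s (s<s (s<s z<s)))) ,
       increasing⇒⊆word ((i<p ∷ i<j ∷ i<k ∷ i<l ∷ []) ∷
         (p<j ∷ ℕ.<-trans p<j j<k ∷ ℕ.<-trans p<j j<l ∷ []) ∷ (j<k ∷ j<l ∷ []) ∷ (k<l ∷ []) ∷ [] ∷ [])

  letter-injective⇒Unique-word : (∀ {i j} → letter i ≡ letter j → i ≡ j) → Unique word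
  letter-injective⇒Unique-word inj = Unique.map⁺ inj (Unique.allFin⁺ m)

  Unique-word⇒letter-injective : Unique word → ∀ {i j} → letter i ≡ letter j → i ≡ j
  Unique-word⇒letter-injective u {i} {j} eq = compare (Fin.<-cmp i j)
    where
    distinct : ∀ {i j} → i Fin.< j → letter i ≢ letter j
    distinct i<j = All.head (AllPairs.head (AllPairs-resp-⊆ (increasing⇒⊆word ((i<j ∷ []) ∷ [] ∷ [])) u))
    compare : Tri (i Fin.< j) (i ≡ j) (j Fin.< i) → i ≡ j
    compare (tri≈ _ i≡j _) = i≡j
    compare (tri< i<j _ _) = contradiction eq       (distinct i<j)
    compare (tri> _ _ j<i) = contradiction (sym eq) (distinct j<i)

  Avoids⇒AvoidsBarred : (∀ {i j} → letter i ≡ letter j → i ≡ j) → Avoids word → AvoidsBarred π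
  Avoids⇒AvoidsBarred inj avoids i j k l i<j j<k k<l occ =
    let e , d<e , τ = avoids σ a<b b<c c<d in barred d<e (⊆word⇒increasing τ)
    where
    a<b = Equivalence.from (occ 3F 1F) (s<s z<s)
    b<c = Equivalence.from (occ 1F 0F) (s<s (s<s z<s))
    c<d = Equivalence.from (occ 0F 2F) (s<s (s<s (s<s z<s)))
    σ : letter i ∷ letter j ∷ letter k ∷ letter l ∷ [] ⊆ word
    σ = increasing⇒⊆word ((i<j ∷ ℕ.<-trans i<j j<k ∷ ℕ.<-trans (ℕ.<-trans i<j j<k) k<l ∷ []) ∷
                         (j<k ∷ ℕ.<-trans j<k k<l ∷ []) ∷ (k<l ∷ []) ∷ [] ∷ [])
    barred : ∀ {e} → letter k < e →
             (∃ λ is → AllPairs Fin._<_ is × map letter is ≡ letter i ∷ e ∷ letter j ∷ letter k ∷ letter l ∷ []) →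
             ∃ λ p → i Fin.< p × p Fin.< j × Occurs π (i ∷ p ∷ j ∷ k ∷ l ∷ []) pattern35241
    -- The lifted positions are known only through their letters. `inj` identifies the first and
    -- third of them with `i` and `j`, which places `p` in between.
    barred d<e (i′ ∷ p ∷ j′ ∷ k′ ∷ l′ ∷ [] , ((i<p ∷ _) ∷ (p<j ∷ _) ∷ _) , eq)
      with refl ← inj (List.∷-injectiveˡ eq)
         | refl ← List.∷-injectiveˡ (List.∷-injectiveʳ eq)
         | refl ← inj (List.∷-injectiveˡ (List.∷-injectiveʳ (List.∷-injectiveʳ eq))) =
      p , i<p , p<j , occurs-35241 a<b b<c c<d d<e

-- Listed avoiders as pairs over an initial segment of letters

allWords-unique : ∀ n m → Unique (allWords n m)
allWords-unique n zero    = [] ∷ []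
allWords-unique n (suc m) = Unique.cartesianProductWith⁺ _∷_ Vec.∷-injective (Unique.allFin⁺ n) (allWords-unique n m)

∈-allWords : ∀ {n m} (π : Word n m) → π ∈ allWords n m
∈-allWords []      = here refl
∈-allWords (i ∷ π) = ∈-cartesianProductWith⁺ _∷_ (∈-allFin i) (∈-allWords π)

avoiders-size : ∀ n → HasSize (λ (π : Word n n) → IsPermutation π × AvoidsBarred π) (length (avoiders n))
avoiders-size n = hasSize (avoiders n)
  (Unique.filter⁺ avoidsBarred? (Unique.filter⁺ isPermutation? (allWords-unique n n)))
  (λ π → mk⇔
    (λ π∈ → let π∈′ , av = ∈-filter⁻ avoidsBarred? π∈ in proj₂ (∈-filter⁻ isPermutation? {xs = allWords n n} π∈′) , av)
    (λ (perm , av) → ∈-filter⁺ avoidsBarred? (∈-filter⁺ isPermutation? (∈-allWords π) perm) av))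
  refl

word-injective : ∀ {n m} {π ρ : Word n m} → word π ≡ word ρ → π ≡ ρ
word-injective {π = π} {ρ} eq = begin
  π                          ≡⟨ Vec.tabulate∘lookup π ⟨
  Vec.tabulate (lookup π)    ≡⟨ Vec.tabulate-cong (λ i → Fin.toℕ-injective (letters i)) ⟩
  Vec.tabulate (lookup ρ)    ≡⟨ Vec.tabulate∘lookup ρ ⟩
  ρ                          ∎
  where
  open ≡-Reasoning
  map-≡ : ∀ {A B : Set} {f g : A → B} {xs x} → map f xs ≡ map g xs → x ∈ xs → f x ≡ g x
  map-≡ eq (here refl) = List.∷-injectiveˡ eq
  map-≡ eq (there x∈)  = map-≡ (List.∷-injectiveʳ eq) x∈
  letters : ∀ i → letter π i ≡ letter ρ i
  letters i = map-≡ eq (∈-allFin i)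

length-word : ∀ {n m} (π : Word n m) → length (word π) ≡ m
length-word {m = m} π = trans (List.length-map (letter π) (allFin m)) (List.length-tabulate {n = m} id)

word-< : ∀ {n m x} (π : Word n m) → x ∈ word π → x < n
word-< π x∈ with i , _ , refl ← ∈-map⁻ (letter π) x∈ = Fin.toℕ<n (lookup π i)

word-surjective : ∀ {n m} xs → length xs ≡ m → All (_< n) xs → ∃ λ (π : Word n m) → word π ≡ xs
word-surjective xs refl xs<n = fromAll xs xs<n , trans (List.map-tabulate id (letter (fromAll xs xs<n))) (letters xs xs<n)
  where
  fromAll : ∀ {n} xs → All (_< n) xs → Word n (length xs)
  fromAll []       []            = []
  fromAll (x ∷ xs) (x<n ∷ xs<n) = fromℕ< x<n ∷ fromAll xs xs<n
  letters : ∀ {n} xs (xs<n : All (_< n) xs) → tabulate (letter (fromAll xs xs<n)) ≡ xs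
  letters []       []           = refl
  letters (x ∷ xs) (x<n ∷ xs<n) = cong₂ _∷_ (Fin.toℕ-fromℕ< x<n) (letters xs xs<n)

letter-injective : ∀ {n m} {π : Word n m} → VecUnique.Unique π →
                   ∀ {i j} → letter π i ≡ letter π j → i ≡ j
letter-injective u {i} {j} eq = VecUnique.lookup-injective u i j (Fin.toℕ-injective eq)

-- With Q empty and the letters 0 to n - 1, the conditions `desc` and `above` are vacuous, and
-- `Good` reduces to being an avoiding permutation.
Built-downFrom⇔ : ∀ n y → (∃ λ (π : Word n n) → (IsPermutation π × AvoidsBarred π) × y ≡ (word π , [])) ⇔ Built (downFrom n) 0 y
Built-downFrom⇔ n y = mk⇔ to from
  where
  to : ∀ {y} → (∃ λ (π : Word n n) → (IsPermutation π × AvoidsBarred π) × y ≡ (word π , [])) → Built (downFrom n) 0 y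
  to (π , (u , av) , refl) = Good⇒Build (Desc-downFrom n) (record
    { perm   = ↭-trans (↭-reflexive (List.++-identityʳ (word π)))
                 (Unique-⊆⇒↭ (letter-injective⇒Unique-word π (letter-injective u)) (∈-downFrom⁺ ∘ word-< π)
                   (ℕ.≤-reflexive (trans (List.length-downFrom n) (sym (length-word π)))))
    ; desc   = []
    ; avoids = AvoidsBarred⇒Avoids π av
    ; above  = λ _ _ → []
    }) , refl
  from : ∀ {y} → Built (downFrom n) 0 y → ∃ λ (π : Word n n) → (IsPermutation π × AvoidsBarred π) × y ≡ (word π , [])
  from {P , []} (t , refl)
    with P↭ ← Build-↭ (Desc-downFrom n) t
    with π , refl ← word-surjective P (trans (↭.↭-length P↭) (List.length-downFrom n))
                      (All.tabulate (∈-downFrom⁻ ∘ ↭.∈-resp-↭ P↭)) =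
    π , (isPerm , Avoids⇒AvoidsBarred π inj (Good.avoids (Build⇒Good (Desc-downFrom n) t))) , refl
    where
    inj : ∀ {i j} → letter π i ≡ letter π j → i ≡ j
    inj = Unique-word⇒letter-injective π (Unique-resp-↭ (↭-sym P↭) (Unique.downFrom⁺ n))
    isPerm : IsPermutation π
    isPerm = subst IsPermutation (Vec.tabulate∘lookup π) (VecUnique.tabulate⁺ (inj ∘ cong toℕ))

Built-downFrom-size : ∀ n → HasSize (Built (downFrom n) 0) (length (avoiders n))
Built-downFrom-size n = HasSize-cong (Built-downFrom⇔ n)
  (HasSize-image (λ π → word π , []) (λ _ _ eq → word-injective (cong proj₁ eq)) (avoiders-size n))

-- The first term, set to 1 by definition, is also the number of avoiders of length 0, so
-- `length ∘ avoiders` gives the whole sequence.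
avoiderSequence≡ : ∀ n → avoiderSequence n ≡ + length (avoiders n)
avoiderSequence≡ zero    = refl
avoiderSequence≡ (suc n) = refl

theorem1 : IsLeftShiftEigensequence avoiderSequence
theorem1 = solution , λ c → shiftSolution-unique solution
  where
  solution : IsUnitalShiftSolution avoiderSequence
  solution = isUnitalShiftSolution (length ∘ avoiders) avoiderSequence avoiderSequence≡
               (count≡a (length ∘ avoiders) Built-downFrom-size)
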